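{- Let $r,t,\ell,m$ be integers with $1 \le r \le \ell \le m$ and $1 \le t < \ell$. Then $$\hat{\mathfrak w}_r(t;\ell,m) = A(r,t)-A(r,t-1)+ q^{m-1}\mu_{t-1}(\ell-1,m),$$ where for $0\le s<\ell$, $$A(r,s):=q^{s}\, \hat{\mathfrak w}_{r-1}(s;\ell-1,m-1)+q^{s-1}\bigl(\mu_s(\ell-1, m)-\mu_s(\ell-1,m-1)\bigr).$$
   Context: $q$ is a prime power. For nonnegative integers $a,b,t$, $\mu_t(a,b)$ denotes the number of $a\times b$ matrices over $\mathbb{F}_q$ of rank exactly $t$ (so $\mu_0(a,b)=1$ and $\mu_t(a,b)=0$ if $t>\min(a,b)$). For an $a\times b$ matrix $M=(m_{ij})$ and $0\le r\le a$, $\tau_r(M)=m_{11}+\cdots+m_{rr}$, with $\tau_0=0$. For $0\le r\le a$ and $t\ge 0$, $\mathfrak w_r(t;a,b)$ is the number of $a\times b$ matrices $M$ over $\mathbb{F}_q$ of rank exactly $t$ with $\tau_r(M)\ne 0$ (so $\mathfrak w_0(t;a,b)=0$ and $\mathfrak w_r(0;a,b)=0$), and $\hat{\mathfrak w}_r(t;a,b)=\mathfrak w_r(t;a,b)/(q-1)$. -}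

module Defs where

open import Algebra.Bundles using (CommutativeRing)
import Algebra.Definitions.RawMonoid as RawMonoidDefs
import Algebra.Properties.Monoid.Sum as MonoidSum
open import Data.Fin.Base using (Fin; zero; suc; inject≤)
import Data.Fin.Properties as Fin
open import Data.Integer.Base as ℤ using (ℤ; +_; -[1+_])
open import Data.List.Base as List using (List; []; _∷_; length; filter; allFin; cartesianProductWith)
import Data.List.Membership.Propositional.Properties as Mem
import Data.List.Membership.Setoid as SetoidMembership
import Data.List.Membership.Setoid.Properties as SetoidMem
open import Data.List.Relation.Unary.All as All using (all?)
open import Data.List.Relation.Unary.Any as Any using (any?; here)
open import Data.Nat.Base as ℕ using (ℕ; zero; suc; _≤_; _∸_; NonZero)
import Data.Nat.Properties as ℕ
open import Data.Nat.Primality using (Prime)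
open import Data.Product.Base using (Σ; ∃; ∃₂; _×_; _,_)
open import Data.Rational.Base as ℚ using (ℚ)
open import Data.Vec.Functional as Vector using (Vector)
import Data.Vec.Functional.Relation.Binary.Equality.Setoid as VecEq
open import Function.Base using (_∘_)
open import Function.Bundles using (Inverse)
open import Level using (Level; _⊔_) renaming (suc to lsuc)
open import Relation.Binary.Bundles using (Setoid)
open import Relation.Binary.Definitions using (Decidable; _Respects_)
open import Relation.Binary.PropositionalEquality as ≡ using (_≡_)
open import Relation.Nullary using (¬_; Dec; contradiction)
open import Relation.Nullary.Decidable using (map′; _×-dec_; _→-dec_; ¬?)
import Relation.Unary as U

private variable
  a e p : Level

IsPrimePower : ℕ → Set
IsPrimePower q = ∃₂ λ p k → Prime p × 1 ≤ k × q ≡ p ℕ.^ k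

record FiniteField (c ℓ : Level) (q : ℕ) : Set (lsuc (c ⊔ ℓ)) where
  field
    commutativeRing : CommutativeRing c ℓ
  open CommutativeRing commutativeRing public
  field
    1≉0     : ¬ (1# ≈ 0#)
    inverse : ∀ x → ¬ (x ≈ 0#) → ∃ λ y → x * y ≈ 1#
    order   : Inverse (≡.setoid (Fin q)) setoid

ℕ→ℚ : ℕ → ℚ
ℕ→ℚ n = + n ℚ./ 1

infixr 8 _^ᶻ_
_^ᶻ_ : (b : ℕ) .{{_ : NonZero b}} → ℤ → ℚ
b ^ᶻ (+ n)    = ℕ→ℚ (b ℕ.^ n)
b ^ᶻ -[1+ n ] = ℚ._/_ (+ 1) (b ℕ.^ suc n) {{ℕ.m^n≢0 b (suc n)}}

tuples : {A : Set a} → List A → ∀ n → List (Vector A n)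
tuples xs zero    = Vector.[] ∷ []
tuples xs (suc n) = cartesianProductWith Vector._∷_ xs (tuples xs n)

count : {A : Set a} {P : U.Pred A p} → U.Decidable P → List A → ℕ
count P? xs = length (filter P? xs)

-- Decidability of quantifiers over a setoid exhausted by a list.
module Exhaustive (S : Setoid a e) where
  open Setoid S
  open SetoidMembership S using (_∈_)

  Exhausts : List Carrier → Set _
  Exhausts xs = ∀ x → x ∈ xs

  ∃? : ∀ {xs} → Exhausts xs → {P : U.Pred Carrier p} →
       P Respects _≈_ → U.Decidable P → Dec (∃ P)
  ∃? {xs = xs} ex resp P? =
    map′ Any.satisfied
         (λ (x , px) → Any.map (λ x≈y → resp x≈y px) (ex x))
         (any? P? xs)

  ∀? : ∀ {xs} → Exhausts xs → {P : U.Pred Carrier p} →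
       P Respects _≈_ → U.Decidable P → Dec (∀ x → P x)
  ∀? {xs = xs} ex {P} resp P? =
    map′ (λ ps x → All.lookupWith (λ py x≈y → resp (sym x≈y) py) ps (ex x))
         (λ f → All.universal f xs)
         (all? P? xs)

module _ (S : Setoid a e) where
  open Setoid S
  open Exhaustive
  open VecEq S using (≋-setoid)

  tuples-exhausts : ∀ {xs} → Exhausts S xs → ∀ n → Exhausts (≋-setoid n) (tuples xs n)
  tuples-exhausts ex zero    v = here λ ()
  tuples-exhausts {xs} ex (suc n) v =
    Any.map (λ eq → λ { zero → eq zero ; (suc i) → eq (suc i) })
      (SetoidMem.∈-cartesianProductWith⁺ S (≋-setoid n) (≋-setoid (suc n))
        {f = Vector._∷_}
        (λ x≈y u≋v → λ { zero → x≈y ; (suc i) → u≋v i })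
        (ex (Vector.head v)) (tuples-exhausts ex n (Vector.tail v)))

module Counting {c ℓ : Level} {q : ℕ} (F : FiniteField c ℓ q) where
  open FiniteField F
  open Inverse order using (to; from; from-cong; strictlyInverseˡ)
  open RawMonoidDefs +-rawMonoid using (sum)
  open MonoidSum +-monoid using (sum-cong-≋)
  open VecEq setoid using (_≋_; ≋-setoid)
  open Exhaustive using (Exhausts; ∃?; ∀?)

  infix 4 _≟_
  _≟_ : Decidable _≈_
  x ≟ y = map′ (λ eq → trans (sym (strictlyInverseˡ x)) (trans (reflexive (≡.cong to eq)) (strictlyInverseˡ y)))
               from-cong
               (from x Fin.≟ from y)

  private
    from1≢from0 : ¬ (from 1# ≡ from 0#)
    from1≢from0 eq = 1≉0 (trans (sym (strictlyInverseˡ 1#))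
      (trans (reflexive (≡.cong to eq)) (strictlyInverseˡ 0#)))

    2≤ : ∀ {n} (i j : Fin n) → ¬ (i ≡ j) → 2 ≤ n
    2≤ {suc zero}    zero zero i≢j = contradiction ≡.refl i≢j
    2≤ {suc (suc n)} _    _    _   = ℕ.s≤s (ℕ.s≤s ℕ.z≤n)

  2≤q : 2 ≤ q
  2≤q = 2≤ (from 1#) (from 0#) from1≢from0

  instance
    q≢0 : NonZero q
    q≢0 = ℕ.>-nonZero (ℕ.≤-trans (ℕ.n≤1+n 1) 2≤q)

    q∸1≢0 : NonZero (q ∸ 1)
    q∸1≢0 = ℕ.>-nonZero (ℕ.∸-monoˡ-≤ 1 2≤q)

  Matrix : ℕ → ℕ → Set c
  Matrix a b = Vector (Vector Carrier b) a

  -- Each field element, and hence each matrix, is listed exactly once up to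
  -- (entrywise) _≈_.
  elements : List Carrier
  elements = List.map to (allFin q)

  matrices : ∀ a b → List (Matrix a b)
  matrices a b = tuples (tuples elements b) a

  lincomb : ∀ {k b} → Vector Carrier k → Matrix k b → Vector Carrier b
  lincomb x B j = sum λ i → x i * B i j

  LinearlyIndependent : ∀ {k b} → Matrix k b → Set (c ⊔ ℓ)
  LinearlyIndependent B = ∀ x → (∀ j → lincomb x B j ≈ 0#) → ∀ i → x i ≈ 0#

  InRowSpace : ∀ {k b} → Matrix k b → Vector Carrier b → Set (c ⊔ ℓ)
  InRowSpace B v = ∃ λ x → v ≋ lincomb x B

  -- The rows of B form a basis of the row space of M.
  IsRowBasis : ∀ {k a b} → Matrix k b → Matrix a b → Set (c ⊔ ℓ)
  IsRowBasis B M = LinearlyIndependent B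
                 × (∀ i → InRowSpace M (B i))
                 × (∀ i → InRowSpace B (M i))

  -- Rank as the dimension of the row space.
  HasRank : ∀ {a b} → ℕ → Matrix a b → Set (c ⊔ ℓ)
  HasRank {b = b} t M = Σ (Matrix t b) λ B → IsRowBasis B M

  τ : ∀ r {a b} → .(r ≤ a) → .(r ≤ b) → Matrix a b → Carrier
  τ r r≤a r≤b M = sum λ (i : Fin r) → M (inject≤ i r≤a) (inject≤ i r≤b)

  elements-exhausts : Exhausts setoid elements
  elements-exhausts x =
    Any.map (λ eq → trans (sym (strictlyInverseˡ x)) (reflexive eq))
      (Mem.∈-map⁺ to (Mem.∈-allFin (from x)))

  vectors-exhausts : ∀ n → Exhausts (≋-setoid n) (tuples elements n)
  vectors-exhausts = tuples-exhausts setoid elements-exhausts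

  matrixSetoid : ℕ → ℕ → Setoid c ℓ
  matrixSetoid a b = VecEq.≋-setoid (≋-setoid b) a

  matrices-exhausts : ∀ a b → Exhausts (matrixSetoid a b) (matrices a b)
  matrices-exhausts a b = tuples-exhausts (≋-setoid b) (vectors-exhausts b) a

  lincomb-cong : ∀ {k b} {x y : Vector Carrier k} {B C : Matrix k b} →
                 x ≋ y → (∀ i → B i ≋ C i) → lincomb x B ≋ lincomb y C
  lincomb-cong x≋y B≋C j = sum-cong-≋ λ i → *-cong (x≋y i) (B≋C i j)

  private
    ≋-refl′ : ∀ {k b} (B : Matrix k b) → ∀ i → B i ≋ B i
    ≋-refl′ B i j = refl

  linearlyIndependent? : ∀ {k b} → U.Decidable (LinearlyIndependent {k} {b})
  linearlyIndependent? {k} {b} B = ∀? (≋-setoid k) (vectors-exhausts k)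
    (λ x≋y f y0 i → trans (sym (x≋y i))
      (f (λ j → trans (lincomb-cong x≋y (≋-refl′ B) j) (y0 j)) i))
    (λ x → Fin.all? (λ j → lincomb x B j ≟ 0#) →-dec Fin.all? (λ i → x i ≟ 0#))

  inRowSpace? : ∀ {k b} (B : Matrix k b) → U.Decidable (InRowSpace B)
  inRowSpace? {k} B v = ∃? (≋-setoid k) (vectors-exhausts k)
    (λ x≋y eq j → trans (eq j) (lincomb-cong x≋y (≋-refl′ B) j))
    (λ x → Fin.all? λ j → v j ≟ lincomb x B j)

  isRowBasis? : ∀ {k a b} (B : Matrix k b) (M : Matrix a b) → Dec (IsRowBasis B M)
  isRowBasis? B M = linearlyIndependent? B
              ×-dec Fin.all? (λ i → inRowSpace? M (B i))
              ×-dec Fin.all? (λ i → inRowSpace? B (M i))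

  hasRank? : ∀ {a b} t → U.Decidable (HasRank {a} {b} t)
  hasRank? {b = b} t M = ∃? (matrixSetoid t b) (matrices-exhausts t b)
    (λ B≋C (ind , inM , inB) →
        (λ x x0 → ind x λ j → trans (lincomb-cong (λ _ → refl) B≋C j) (x0 j))
      , (λ i → let (x , eq) = inM i in x , λ j → trans (sym (B≋C i j)) (eq j))
      , (λ i → let (x , eq) = inB i in x , λ j → trans (eq j) (lincomb-cong (λ _ → refl) B≋C j)))
    (λ B → isRowBasis? B M)

  μ : (t a b : ℕ) → ℕ
  μ t a b = count (hasRank? t) (matrices a b)

  𝔴 : (r t a b : ℕ) → .(r ≤ a) → .(r ≤ b) → ℕ
  𝔴 r t a b r≤a r≤b =
    count (λ M → hasRank? t M ×-dec ¬? (τ r r≤a r≤b M ≟ 0#)) (matrices a b)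

  𝔴̂ : (r t a b : ℕ) → .(r ≤ a) → .(r ≤ b) → ℚ
  𝔴̂ r t a b r≤a r≤b = + 𝔴 r t a b r≤a r≤b ℚ./ (q ∸ 1)

  -- Used for r, l, m ≥ 1 only, where ∸ 1 is genuine subtraction.  The exponent
  -- s - 1 is an integer, equal to -1 when s = 0.
  A : (l m r s : ℕ) → .(r ≤ l) → .(r ≤ m) → ℚ
  A l m r s r≤l r≤m =
    q ^ᶻ (+ s) ℚ.* 𝔴̂ (r ∸ 1) s (l ∸ 1) (m ∸ 1) (ℕ.∸-monoˡ-≤ 1 r≤l) (ℕ.∸-monoˡ-≤ 1 r≤m)
    ℚ.+ q ^ᶻ (+ s ℤ.- + 1) ℚ.* (ℕ→ℚ (μ s (l ∸ 1) m) ℚ.- ℕ→ℚ (μ s (l ∸ 1) (m ∸ 1)))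

{-# OPTIONS --safe #-}
module Submission where

-- Write M = v ∷ N with v the first row.  The rank of M is that of N if v lies in
-- the row space of N and one more otherwise, and τ_r(M) = v₁ + τ′(N), where τ′ is
-- τ_{r-1} of N without its first column.  With
--   W(s) = Σ_{rank N = s} #{v in the row space of N : v₁ + τ′(N) ≠ 0},
-- summing over v gives w_r(t) + W(t-1) = W(t) + (q-1) q^(m-1) μ_{t-1}(ℓ-1,m).  On
-- the row space of N, v₁ vanishes identically if the first column of N is zero and
-- is equidistributed otherwise, which gives W(s) = (q-1) A(r,s).
-- Uniqueness of the rank comes from |row space| = q^rank.

import Algebra.Properties.Ring as RingProperties
import Algebra.Properties.Semiring.Sum as SemiringSum
open import Data.Bool.Base using (true; false; if_then_else_)
open import Data.Fin.Base using (Fin; zero; suc; inject≤)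
import Data.Fin.Properties as Fin
open import Data.List.Base as List using (List; []; _∷_; cartesianProductWith)
import Data.List.Properties as List
open import Data.Nat.ListAction using (sum)
open import Data.Nat.ListAction.Properties using (sum-++)
import Data.Nat.Properties as ℕ
import Data.Nat.Solver as ℕ-Solver
open import Data.Product.Base using (∃; _×_; _,_)
open import Data.Rational.Base as ℚ using (ℚ)
import Data.Rational.Properties as ℚ
import Data.Rational.Solver as ℚ-Solver
import Data.Rational.Unnormalised.Base as ℚᵘ
import Data.Rational.Unnormalised.Properties as ℚᵘ
import Data.Integer.Properties as ℤ
open import Data.Vec.Functional as Vector using (Vector)
import Data.Vec.Functional.Relation.Binary.Equality.Setoid as VecEq
open import Function.Base using (_∘_; id)
open import Function.Bundles using (Inverse)
open import Function.Definitions using (Congruent)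
open import Relation.Binary.Bundles using (Setoid)
open import Relation.Binary.Definitions using (tri<; tri≈; tri>)
import Relation.Binary.PropositionalEquality as ≡
import Relation.Binary.Reasoning.Setoid as SetoidReasoning
open import Relation.Nullary using (¬_; Dec; yes; no; does; contradiction)
open import Relation.Nullary.Decidable using (_×-dec_; ¬?)
import Relation.Unary as U

open import Defs
open import Data.Nat.Base as ℕ using (ℕ; _≤_; _<_; _∸_; zero; suc; NonZero; s≤s)
open import Level using (Level; _⊔_)
open import Relation.Binary.PropositionalEquality using (_≡_)

-- The goal involves division by q - 1, the exponent s - 1 and differences of counts. The
-- combinatorics therefore stays in ℕ, as identities between sums of 0/1 indicators, with negative
-- terms moved across and denominators cleared; ℚ enters only at the end.
--
-- Equidistribution comes from coordinates. A row basis B of N identifies the row space with the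
-- s-tuples x, and v₁ becomes the linear form Σ xᵢ Bᵢ₁, nonzero exactly when the first column of N
-- is. A nonzero form plus a constant is nonzero at (q-1) q^(s-1) tuples, which accounts for the
-- difference of the two μ_s in A. Matrices with zero first column are matrices with one column less
-- and account for the term with r - 1.
--
-- `HasRank` asserts the existence of a row basis, so each construction on bases gives only one
-- implication; existence and uniqueness of the rank supply the converses that counting needs.

private variable
  a b ℓ : Level
  X : Set a
  Y : Set b
  P Q : Set ℓ

-- Sums over lists and indicators of decidable propositions.

∑ : List X → (X → ℕ) → ℕ
∑ xs f = sum (List.map f xs)

infixl 5 ∑
syntax ∑ xs (λ x → e) = ∑[ x ∈ xs ] e

𝟙 : Dec P → ℕ
𝟙 d = if does d then 1 else 0

module ListSums where
  open import Data.Nat.Base using (_+_; _*_)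
  open ≡ using (refl; sym; trans; cong; cong₂)
  open ≡.≡-Reasoning
  open ℕ-Solver.+-*-Solver

  𝟙-yes : (d : Dec P) → P → 𝟙 d ≡ 1
  𝟙-yes (yes _) _ = refl
  𝟙-yes (no ¬p) p = contradiction p ¬p

  𝟙-no : (d : Dec P) → ¬ P → 𝟙 d ≡ 0
  𝟙-no (yes p) ¬p = contradiction p ¬p
  𝟙-no (no _)  _  = refl

  𝟙-cong : (d : Dec P) (d′ : Dec Q) → (P → Q) → (Q → P) → 𝟙 d ≡ 𝟙 d′
  𝟙-cong (yes p) d′ f g = sym (𝟙-yes d′ (f p))
  𝟙-cong (no ¬p) d′ f g = sym (𝟙-no d′ (¬p ∘ g))

  𝟙-× : (d : Dec P) (d′ : Dec Q) → 𝟙 (d ×-dec d′) ≡ 𝟙 d * 𝟙 d′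
  𝟙-× (yes _) (yes _) = refl
  𝟙-× (yes _) (no _)  = refl
  𝟙-× (no _)  _       = refl

  𝟙-¬ : (d : Dec P) → 𝟙 d + 𝟙 (¬? d) ≡ 1
  𝟙-¬ (yes _) = refl
  𝟙-¬ (no _)  = refl

  𝟙*-cases : ∀ (d : Dec P) {x y} → (P → x ≡ y) → (¬ P → 0 ≡ y) → 𝟙 d * x ≡ y
  𝟙*-cases (yes p) f g = trans (ℕ.*-identityˡ _) (f p)
  𝟙*-cases (no ¬p) f g = g ¬p

  -- The factor `𝟙 d` vanishes unless P holds, so an identity that has P as a hypothesis can be used
  -- under a sum over all matrices, as `rank-hits` is in `first-column`.
  𝟙*-congˡ : ∀ (d : Dec P) {x y} → (P → x ≡ y) → 𝟙 d * x ≡ 𝟙 d * y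
  𝟙*-congˡ (yes p) f = cong (_+ 0) (f p)
  𝟙*-congˡ (no ¬p) f = refl

  ∑-cong : ∀ (xs : List X) {f g : X → ℕ} → (∀ x → f x ≡ g x) → ∑ xs f ≡ ∑ xs g
  ∑-cong xs f≗g = cong sum (List.map-cong f≗g xs)

  ∑-zero : ∀ (xs : List X) {f : X → ℕ} → (∀ x → f x ≡ 0) → ∑ xs f ≡ 0
  ∑-zero []       f≗0 = refl
  ∑-zero (x ∷ xs) f≗0 = cong₂ _+_ (f≗0 x) (∑-zero xs f≗0)

  ∑-+ : ∀ (xs : List X) (f g : X → ℕ) → (∑[ x ∈ xs ] f x + g x) ≡ ∑ xs f + ∑ xs g
  ∑-+ []       f g = refl
  ∑-+ (x ∷ xs) f g = begin
    f x + g x + (∑[ y ∈ xs ] f y + g y)  ≡⟨ cong (λ s → f x + g x + s) (∑-+ xs f g) ⟩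
    f x + g x + (∑ xs f + ∑ xs g)        ≡⟨ solve 4 (λ a b c d → a :+ b :+ (c :+ d) := a :+ c :+ (b :+ d)) refl (f x) (g x) (∑ xs f) (∑ xs g) ⟩
    f x + ∑ xs f + (g x + ∑ xs g)        ∎

  ∑-*ˡ : ∀ (xs : List X) k (f : X → ℕ) → (∑[ x ∈ xs ] k * f x) ≡ k * ∑ xs f
  ∑-*ˡ []       k f = sym (ℕ.*-zeroʳ k)
  ∑-*ˡ (x ∷ xs) k f = trans (cong (_+_ (k * f x)) (∑-*ˡ xs k f)) (sym (ℕ.*-distribˡ-+ k (f x) (∑ xs f)))

  ∑-*ʳ : ∀ (xs : List X) (f : X → ℕ) k → (∑[ x ∈ xs ] f x * k) ≡ ∑ xs f * k
  ∑-*ʳ []       f k = refl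
  ∑-*ʳ (x ∷ xs) f k = trans (cong (_+_ (f x * k)) (∑-*ʳ xs f k)) (sym (ℕ.*-distribʳ-+ k (f x) (∑ xs f)))

  ∑-swap : ∀ (xs : List X) (ys : List Y) (f : X → Y → ℕ) →
           (∑[ x ∈ xs ] ∑[ y ∈ ys ] f x y) ≡ (∑[ y ∈ ys ] ∑[ x ∈ xs ] f x y)
  ∑-swap []       ys f = sym (∑-zero ys λ _ → refl)
  ∑-swap (x ∷ xs) ys f = trans (cong (_+_ (∑ ys (f x))) (∑-swap xs ys f)) (sym (∑-+ ys (f x) _))

  ∑-cartesianProductWith : ∀ {z} {Z : Set z} (g : X → Y → Z) xs ys (f : Z → ℕ) →
    ∑ (cartesianProductWith g xs ys) f ≡ (∑[ x ∈ xs ] ∑[ y ∈ ys ] f (g x y))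
  ∑-cartesianProductWith g []       ys f = refl
  ∑-cartesianProductWith g (x ∷ xs) ys f = begin
    sum (List.map f (List.map (g x) ys List.++ zs))            ≡⟨ cong sum (List.map-++ f (List.map (g x) ys) zs) ⟩
    sum (List.map f (List.map (g x) ys) List.++ List.map f zs) ≡⟨ sum-++ (List.map f (List.map (g x) ys)) _ ⟩
    sum (List.map f (List.map (g x) ys)) + ∑ zs f              ≡⟨ cong₂ _+_ (cong sum (sym (List.map-∘ ys))) (∑-cartesianProductWith g xs ys f) ⟩
    ∑ ys (f ∘ g x) + (∑[ y ∈ xs ] ∑[ z ∈ ys ] f (g y z))       ∎
    where zs = cartesianProductWith g xs ys

  ∑-tuples : ∀ (xs : List X) n (f : Vector X (suc n) → ℕ) →
             ∑ (tuples xs (suc n)) f ≡ (∑[ x ∈ xs ] ∑[ v ∈ tuples xs n ] f (x Vector.∷ v))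
  ∑-tuples xs n = ∑-cartesianProductWith Vector._∷_ xs (tuples xs n)

  ∑-tabulate-zero : ∀ {n} (g : Fin n → X) {f : X → ℕ} → (∀ i → f (g i) ≡ 0) → ∑ (List.tabulate g) f ≡ 0
  ∑-tabulate-zero {n = zero}  g f≗0 = refl
  ∑-tabulate-zero {n = suc n} g f≗0 = cong₂ _+_ (f≗0 zero) (∑-tabulate-zero (g ∘ suc) (f≗0 ∘ suc))

  ∑-tabulate-single : ∀ {n} (g : Fin n → X) {f : X → ℕ} j →
                      (∀ i → ¬ i ≡ j → f (g i) ≡ 0) → ∑ (List.tabulate g) f ≡ f (g j)
  ∑-tabulate-single g {f} zero    off =
    trans (cong (_+_ (f (g zero))) (∑-tabulate-zero (g ∘ suc) λ i → off (suc i) λ ())) (ℕ.+-identityʳ _)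
  ∑-tabulate-single g     (suc j) off =
    cong₂ _+_ (off zero λ ()) (∑-tabulate-single (g ∘ suc) j λ i i≢j → off (suc i) (i≢j ∘ Fin.suc-injective))

  count≡∑ : ∀ {P : U.Pred X ℓ} (P? : U.Decidable P) xs → count P? xs ≡ (∑[ x ∈ xs ] 𝟙 (P? x))
  count≡∑ P? []       = refl
  count≡∑ P? (x ∷ xs) with does (P? x)
  ... | true  = cong suc (count≡∑ P? xs)
  ... | false = count≡∑ P? xs

  ∑-one : ∀ (xs : List X) → (∑[ x ∈ xs ] 1) ≡ List.length xs
  ∑-one []       = refl
  ∑-one (x ∷ xs) = cong suc (∑-one xs)

  ∑-const : ∀ (xs : List X) k → (∑[ x ∈ xs ] k) ≡ List.length xs * k
  ∑-const []       k = refl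
  ∑-const (x ∷ xs) k = cong (_+_ k) (∑-const xs k)

  length-tuples : ∀ (xs : List X) n → List.length (tuples xs n) ≡ List.length xs ℕ.^ n
  length-tuples xs zero    = refl
  length-tuples xs (suc n) = begin
    List.length (tuples xs (suc n))                  ≡⟨ ∑-one (tuples xs (suc n)) ⟨
    (∑[ v ∈ tuples xs (suc n) ] 1)                   ≡⟨ ∑-tuples xs n (λ _ → 1) ⟩
    (∑[ x ∈ xs ] ∑[ v ∈ tuples xs n ] 1)             ≡⟨ ∑-const xs _ ⟩
    List.length xs * (∑[ v ∈ tuples xs n ] 1)        ≡⟨ cong (List.length xs *_) (trans (∑-one (tuples xs n)) (length-tuples xs n)) ⟩
    List.length xs * List.length xs ℕ.^ n            ∎

open ListSums

-- A function f supported on the class of w sums to f w exactly when the list meets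
-- that class once; no decidability of the setoid equality is involved.
module _ {a e} (S : Setoid a e) where
  open Setoid S

  Enumerates : List Carrier → Set (a ⊔ e)
  Enumerates xs = ∀ w {f : Carrier → ℕ} → Congruent _≈_ _≡_ f →
                  (∀ v → ¬ v ≈ w → f v ≡ 0) → ∑ xs f ≡ f w

module _ {a e} (S : Setoid a e) where
  open Setoid S
  open VecEq S using (_≋_; ≋-setoid)
  open ≡.≡-Reasoning

  ∷-cong : ∀ {n x y} {u v : Vector Carrier n} → x ≈ y → u ≋ v → (x Vector.∷ u) ≋ (y Vector.∷ v)
  ∷-cong x≈y u≋v zero    = x≈y
  ∷-cong x≈y u≋v (suc i) = u≋v i

  -- A vector is a function on `Fin`, so cutting it into head and tail recovers it only pointwise;
  -- results about `v ∷ N` reach a general matrix through this and a congruence lemma.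
  head∷tail : ∀ {n} (v : Vector Carrier (suc n)) → (Vector.head v Vector.∷ Vector.tail v) ≋ v
  head∷tail v zero    = refl
  head∷tail v (suc i) = refl

  -- With the sum over heads outermost, the inner sum vanishes unless the head is in the class of
  -- `w zero`; the one that survives is supported on the class of the tail of `w`.
  tuples-enumerates : ∀ {xs} → Enumerates S xs → ∀ n → Enumerates (≋-setoid n) (tuples xs n)
  tuples-enumerates      enum zero    w {f} f-cong off = ≡.trans (ℕ.+-identityʳ _) (f-cong λ ())
  tuples-enumerates {xs} enum (suc n) w {f} f-cong off = begin
    ∑ (tuples xs (suc n)) f                                    ≡⟨ ∑-tuples xs n f ⟩
    (∑[ x ∈ xs ] ∑[ v ∈ tuples xs n ] f (x Vector.∷ v))        ≡⟨ enum (w zero)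
        (λ x≈y → ∑-cong (tuples xs n) λ v → f-cong (∷-cong x≈y λ _ → refl))
        (λ x x≉ → ∑-zero (tuples xs n) λ v → off _ λ eq → x≉ (eq zero)) ⟩
    (∑[ v ∈ tuples xs n ] f (w zero Vector.∷ v))               ≡⟨ tuples-enumerates enum n (Vector.tail w)
        (λ u≋v → f-cong (∷-cong refl u≋v))
        (λ v v≉ → off _ λ eq → v≉ (eq ∘ suc)) ⟩
    f (w zero Vector.∷ Vector.tail w)                          ≡⟨ f-cong (head∷tail w) ⟩
    f w                                                        ∎

-- Row spaces

module RowSpaces {c e q} (F : FiniteField c e q) where
  open FiniteField F hiding (zero)
  open Counting F
  open VecEq setoid using (_≋_; ≋-setoid)
  open SemiringSum semiring using (sum-cong-≋; ∑-distrib-+; *-distribˡ-sum; sum-replicate-zero)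
  open RingProperties ring using (-‿distribˡ-*; -‿distribʳ-*; -1*x≈-x; -‿involutive; +-inverseˡ-unique)
  open SetoidReasoning setoid

  lincomb-zeroˡ : ∀ {k n} {x : Vector Carrier k} (B : Matrix k n) →
                  (∀ i → x i ≈ 0#) → ∀ j → lincomb x B j ≈ 0#
  lincomb-zeroˡ {k} B x≈0 j =
    trans (sum-cong-≋ λ i → trans (*-congʳ (x≈0 i)) (zeroˡ (B i j))) (sum-replicate-zero k)

  lincomb-zeroʳ : ∀ {k n} (x : Vector Carrier k) (B : Matrix k n) j →
                  (∀ i → B i j ≈ 0#) → lincomb x B j ≈ 0#
  lincomb-zeroʳ {k} x B j B≈0 =
    trans (sum-cong-≋ λ i → trans (*-congˡ (B≈0 i)) (zeroʳ (x i))) (sum-replicate-zero k)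

  lincomb-+ : ∀ {k n} (x y : Vector Carrier k) (B : Matrix k n) j →
              lincomb (λ i → x i + y i) B j ≈ lincomb x B j + lincomb y B j
  lincomb-+ x y B j =
    trans (sum-cong-≋ λ i → distribʳ (B i j) (x i) (y i)) (∑-distrib-+ (λ i → x i * B i j) (λ i → y i * B i j))

  lincomb-* : ∀ {k n} z (x : Vector Carrier k) (B : Matrix k n) j →
              lincomb (λ i → z * x i) B j ≈ z * lincomb x B j
  lincomb-* z x B j =
    trans (sum-cong-≋ λ i → *-assoc z (x i) (B i j)) (sym (*-distribˡ-sum z (λ i → x i * B i j)))

  -- Associativity of the matrix product x Y B. Induction on the rows of Y uses only linearity in
  -- the coefficients, with no exchange of double sums.
  lincomb-assoc : ∀ {h k n} (x : Vector Carrier h) (Y : Matrix h k) (B : Matrix k n) j →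
                  lincomb x (λ i → lincomb (Y i) B) j ≈ lincomb (lincomb x Y) B j
  lincomb-assoc {zero}  x Y B j = sym (lincomb-zeroˡ B (λ _ → refl) j)
  lincomb-assoc {suc h} x Y B j = begin
    x zero * lincomb (Y zero) B j + lincomb x′ (λ i → lincomb (Y′ i) B) j
      ≈⟨ +-cong (sym (lincomb-* (x zero) (Y zero) B j)) (lincomb-assoc x′ Y′ B j) ⟩
    lincomb (λ i → x zero * Y zero i) B j + lincomb (lincomb x′ Y′) B j
      ≈⟨ lincomb-+ (λ i → x zero * Y zero i) (lincomb x′ Y′) B j ⟨
    lincomb (lincomb x Y) B j ∎
    where
    x′ = Vector.tail x
    Y′ = Vector.tail Y

  InRowSpace-cong : ∀ {k n} {M N : Matrix k n} {v w} → (∀ i → M i ≋ N i) → v ≋ w →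
                    InRowSpace M v → InRowSpace N w
  InRowSpace-cong M≋N v≋w (x , eq) =
    x , λ j → trans (sym (v≋w j)) (trans (eq j) (lincomb-cong (λ _ → refl) M≋N j))

  InRowSpace-⊆ : ∀ {h k n} {M : Matrix h n} {N : Matrix k n} → (∀ i → InRowSpace N (M i)) →
                 ∀ {v} → InRowSpace M v → InRowSpace N v
  InRowSpace-⊆ {M = M} {N} M⊆N {v} (x , v≋xM) = lincomb x C , λ j → begin
    v j                                   ≈⟨ v≋xM j ⟩
    lincomb x M j                         ≈⟨ lincomb-cong (λ _ → refl) (λ i → let (_ , eq) = M⊆N i in eq) j ⟩
    lincomb x (λ i → lincomb (C i) N) j   ≈⟨ lincomb-assoc x C N j ⟩
    lincomb (lincomb x C) N j             ∎
    where
    C : Matrix _ _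
    C i = let (y , _) = M⊆N i in y

  InRowSpace-tail : ∀ {k n} {v w} {N : Matrix k n} → InRowSpace N w → InRowSpace (v Vector.∷ N) w
  InRowSpace-tail {v = v} (x , eq) =
    (0# Vector.∷ x) , λ j → trans (eq j) (sym (trans (+-congʳ (zeroˡ (v j))) (+-identityˡ _)))

  InRowSpace-head : ∀ {k n} (v : Vector Carrier n) (N : Matrix k n) → InRowSpace (v Vector.∷ N) v
  InRowSpace-head v N = (1# Vector.∷ λ _ → 0#) , λ j → sym (begin
    1# * v j + lincomb (λ _ → 0#) N j   ≈⟨ +-cong (*-identityˡ (v j)) (lincomb-zeroˡ N (λ _ → refl) j) ⟩
    v j + 0#                            ≈⟨ +-identityʳ (v j) ⟩
    v j                                 ∎)

  row∈rowSpace : ∀ {k n} (M : Matrix k n) i → InRowSpace M (M i)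
  row∈rowSpace {suc k} M i =
    InRowSpace-cong (head∷tail (≋-setoid _) M) (λ _ → refl) (split i)
    where
    split : ∀ i → InRowSpace (Vector.head M Vector.∷ Vector.tail M) (M i)
    split zero    = InRowSpace-head (M zero) (Vector.tail M)
    split (suc i) = InRowSpace-tail (row∈rowSpace (Vector.tail M) i)

  HasRank-cong : ∀ {k n t} {M N : Matrix k n} → (∀ i → M i ≋ N i) → HasRank t M → HasRank t N
  HasRank-cong M≋N (B , ind , B⊆M , M⊆B) =
    B , ind , (λ i → InRowSpace-cong M≋N (λ _ → refl) (B⊆M i))
            , (λ i → InRowSpace-cong (λ _ _ → refl) (M≋N i) (M⊆B i))

  -- Independence is applied to x - y, written x + (-1) y so that `lincomb-+` and `lincomb-*` split
  -- its combination.
  independent-injective : ∀ {k n} {B : Matrix k n} → LinearlyIndependent B →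
                          ∀ x y → lincomb x B ≋ lincomb y B → x ≋ y
  independent-injective {B = B} ind x y xB≋yB i =
    trans (+-inverseˡ-unique (x i) _ (ind (λ i → x i + (- 1#) * y i) x-y i))
          (trans (-‿cong (-1*x≈-x (y i))) (-‿involutive (y i)))
    where
    x-y : ∀ j → lincomb (λ i → x i + (- 1#) * y i) B j ≈ 0#
    x-y j = begin
      lincomb (λ i → x i + (- 1#) * y i) B j            ≈⟨ lincomb-+ x (λ i → (- 1#) * y i) B j ⟩
      lincomb x B j + lincomb (λ i → (- 1#) * y i) B j  ≈⟨ +-cong (xB≋yB j) (lincomb-* (- 1#) y B j) ⟩
      lincomb y B j + (- 1#) * lincomb y B j            ≈⟨ +-congˡ (-1*x≈-x _) ⟩
      lincomb y B j + - lincomb y B j                   ≈⟨ -‿inverseʳ _ ⟩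
      0#                                                ∎

  rank-∷-dependent : ∀ {k n s} {v} {N : Matrix k n} → InRowSpace N v → HasRank s N → HasRank s (v Vector.∷ N)
  rank-∷-dependent v∈N (B , ind , B⊆N , N⊆B) =
    B , ind , (λ i → InRowSpace-tail (B⊆N i)) , λ { zero → InRowSpace-⊆ N⊆B v∈N ; (suc i) → N⊆B i }

  -- In a relation x₀ v + x′ B = 0, a nonzero x₀ could be divided out to put v in the row space of
  -- B. Hence x₀ = 0, and what remains is a relation among the rows of B.
  independent-∷ : ∀ {k n} {v} {B : Matrix k n} → ¬ InRowSpace B v →
                  LinearlyIndependent B → LinearlyIndependent (v Vector.∷ B)
  independent-∷ {v = v} {B} v∉B ind x xvB≈0 with x zero ≟ 0#
  ... | yes x₀≈0 = λ { zero → x₀≈0 ; (suc i) → ind (Vector.tail x) x′B≈0 i }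
    where
    x′B≈0 : ∀ j → lincomb (Vector.tail x) B j ≈ 0#
    x′B≈0 j = begin
      lincomb (Vector.tail x) B j                   ≈⟨ +-identityˡ _ ⟨
      0# + lincomb (Vector.tail x) B j              ≈⟨ +-congʳ (trans (*-congʳ x₀≈0) (zeroˡ (v j))) ⟨
      x zero * v j + lincomb (Vector.tail x) B j    ≈⟨ xvB≈0 j ⟩
      0#                                            ∎
  ... | no x₀≉0 with inverse (x zero) x₀≉0
  ... | x₀⁻¹ , x₀x₀⁻¹≈1 = contradiction ((λ i → - x₀⁻¹ * x′ i) , v≋) v∉B
    where
    x₀ = Vector.head x
    x′ = Vector.tail x
    v≋ : v ≋ lincomb (λ i → - x₀⁻¹ * x′ i) B
    v≋ j = begin
      v j                              ≈⟨ *-identityˡ (v j) ⟨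
      1# * v j                         ≈⟨ *-congʳ (trans (*-comm x₀⁻¹ x₀) x₀x₀⁻¹≈1) ⟨
      x₀⁻¹ * x₀ * v j                  ≈⟨ *-assoc x₀⁻¹ x₀ (v j) ⟩
      x₀⁻¹ * (x₀ * v j)                ≈⟨ *-congˡ (+-inverseˡ-unique _ _ (xvB≈0 j)) ⟩
      x₀⁻¹ * - lincomb x′ B j          ≈⟨ -‿distribʳ-* x₀⁻¹ _ ⟨
      - (x₀⁻¹ * lincomb x′ B j)        ≈⟨ -‿distribˡ-* x₀⁻¹ _ ⟩
      - x₀⁻¹ * lincomb x′ B j          ≈⟨ lincomb-* (- x₀⁻¹) x′ B j ⟨
      lincomb (λ i → - x₀⁻¹ * x′ i) B j ∎

  rank-∷-independent : ∀ {k n s} {v} {N : Matrix k n} → ¬ InRowSpace N v → HasRank s N → HasRank (suc s) (v Vector.∷ N)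
  rank-∷-independent {v = v} {N} v∉N (B , ind , B⊆N , N⊆B) =
    v Vector.∷ B , independent-∷ (v∉N ∘ InRowSpace-⊆ B⊆N) ind
    , (λ { zero → InRowSpace-head v N ; (suc i) → InRowSpace-tail (B⊆N i) })
    , (λ { zero → InRowSpace-head v B ; (suc i) → InRowSpace-tail (N⊆B i) })

  -- The basis grows from the last row upwards: each new first row is discarded if it lies in the
  -- span already and added otherwise.
  rank-exists : ∀ {k n} (M : Matrix k n) → ∃ λ s → HasRank s M
  rank-exists {zero}  M = 0 , (λ ()) , (λ _ _ ()) , (λ ()) , (λ ())
  rank-exists {suc k} M with rank-exists (Vector.tail M) | inRowSpace? (Vector.tail M) (Vector.head M)
  ... | s , r | yes v∈N = s     , HasRank-cong (head∷tail (≋-setoid _) M) (rank-∷-dependent v∈N r)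
  ... | s , r | no  v∉N = suc s , HasRank-cong (head∷tail (≋-setoid _) M) (rank-∷-independent v∉N r)

  affine-root : ∀ {b} → ¬ b ≈ 0# → ∀ d → ∃ λ w → w * b + d ≈ 0# × (∀ x → x * b + d ≈ 0# → x ≈ w)
  affine-root {b} b≉0 d with inverse b b≉0
  ... | b⁻¹ , bb⁻¹≈1 = - d * b⁻¹ , root , unique
    where
    root : - d * b⁻¹ * b + d ≈ 0#
    root = begin
      - d * b⁻¹ * b + d    ≈⟨ +-congʳ (*-assoc (- d) b⁻¹ b) ⟩
      - d * (b⁻¹ * b) + d  ≈⟨ +-congʳ (*-congˡ (trans (*-comm b⁻¹ b) bb⁻¹≈1)) ⟩
      - d * 1# + d         ≈⟨ +-congʳ (*-identityʳ (- d)) ⟩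
      - d + d              ≈⟨ -‿inverseˡ d ⟩
      0#                   ∎
    unique : ∀ x → x * b + d ≈ 0# → x ≈ - d * b⁻¹
    unique x eq = begin
      x              ≈⟨ *-identityʳ x ⟨
      x * 1#         ≈⟨ *-congˡ bb⁻¹≈1 ⟨
      x * (b * b⁻¹)  ≈⟨ *-assoc x b b⁻¹ ⟨
      x * b * b⁻¹    ≈⟨ *-congʳ (+-inverseˡ-unique (x * b) d eq) ⟩
      - d * b⁻¹      ∎

  ZeroColumn : ∀ {k n} → Matrix k (suc n) → Set e
  ZeroColumn N = ∀ i → N i zero ≈ 0#

  zeroColumn? : ∀ {k n} → U.Decidable (ZeroColumn {k} {n})
  zeroColumn? N = Fin.all? λ i → N i zero ≟ 0#

  zeroColumn-⊆ : ∀ {h k n} {M : Matrix h (suc n)} {N : Matrix k (suc n)} →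
                 (∀ i → InRowSpace N (M i)) → ZeroColumn N → ZeroColumn M
  zeroColumn-⊆ {N = N} M⊆N N0 i =
    let (x , eq) = M⊆N i in trans (eq zero) (lincomb-zeroʳ x N zero N0)

  padZero : ∀ {k n} → Matrix k n → Matrix k (suc n)
  padZero N i = 0# Vector.∷ N i

  -- Prefixing a zero entry commutes with linear combinations, so a padded row basis is again a row
  -- basis.
  padZero-rank : ∀ {k n s} {N : Matrix k n} → HasRank s N → HasRank s (padZero N)
  padZero-rank (B , ind , B⊆N , N⊆B) =
    padZero B , (λ x xB≈0 → ind x (xB≈0 ∘ suc)) , (λ i → pad (B⊆N i)) , (λ i → pad (N⊆B i))
    where
    pad : ∀ {k n} {M : Matrix k n} {v} → InRowSpace M v → InRowSpace (padZero M) (0# Vector.∷ v)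
    pad {M = M} (x , eq) =
      x , λ { zero → sym (lincomb-zeroʳ x (padZero M) zero λ _ → refl) ; (suc j) → eq j }

-- Counting in row spaces and over matrices of given rank.

module RankCounts {c e q} (F : FiniteField c e q) where
  open FiniteField F using (Carrier; _≈_; 0#; 1#; 1≉0; setoid; order; semiring; *-congʳ; *-identityʳ)
    renaming (_+_ to _⊕_; _*_ to _⊗_; refl to ≈-refl; sym to ≈-sym; trans to ≈-trans;
              +-congʳ to ⊕-congʳ; +-assoc to ⊕-assoc;
              +-identityˡ to ⊕-identityˡ; *-congˡ to ⊗-congˡ; zeroʳ to ⊗-zeroʳ)
  open Counting F
  open RowSpaces F
  open VecEq setoid using (_≋_; ≋-setoid)
  open SemiringSum semiring using () renaming (sum to sumᶠ; sum-cong-≋ to sumᶠ-cong)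
  open Inverse order using (to; from; from-cong; strictlyInverseˡ; strictlyInverseʳ)
  open import Data.Nat.Base using (_+_; _*_; _^_)
  open ≡ using (refl; sym; trans; cong; cong₂; subst)
  open ≡.≡-Reasoning
  open ℕ-Solver.+-*-Solver using (solve; _:+_; _:*_; _:=_)

  vectors : ∀ n → List (Vector Carrier n)
  vectors n = tuples elements n

  elements-enumerate : Enumerates setoid elements
  elements-enumerate w {f} f-cong off = begin
    ∑ elements f             ≡⟨ cong (λ xs → ∑ xs f) (List.map-tabulate id to) ⟩
    ∑ (List.tabulate to) f   ≡⟨ ∑-tabulate-single to (from w) (λ i i≢ → off (to i) λ eq →
                                  i≢ (trans (sym (strictlyInverseʳ i)) (from-cong eq))) ⟩
    f (to (from w))          ≡⟨ f-cong (strictlyInverseˡ w) ⟩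
    f w                      ∎

  vectors-enumerate : ∀ n → Enumerates (≋-setoid n) (vectors n)
  vectors-enumerate = tuples-enumerates setoid elements-enumerate

  length-elements : List.length elements ≡ q
  length-elements = trans (List.length-map to (List.allFin q)) (List.length-tabulate id)

  length-vectors : ∀ n → List.length (vectors n) ≡ q ^ n
  length-vectors n = trans (length-tuples elements n) (cong (_^ n) length-elements)

  -- The map x ↦ x B is a bijection from s-tuples onto the row space of M. The membership indicator
  -- of v is expanded into the number of x with v ≋ x B, which is 1 or 0 by independence; after
  -- exchanging the sums, the sum over v picks out v = x B.
  ∑-rowSpace : ∀ {s k n} {B : Matrix s n} {M : Matrix k n} → IsRowBasis B M →
               ∀ {f : Vector Carrier n → ℕ} → Congruent _≋_ _≡_ f →
               (∑[ v ∈ vectors n ] 𝟙 (inRowSpace? M v) * f v) ≡ (∑[ x ∈ vectors s ] f (lincomb x B))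
  ∑-rowSpace {s} {k} {n} {B} {M} (ind , B⊆M , M⊆B) {f} f-cong = begin
    (∑[ v ∈ vectors n ] 𝟙 (inRowSpace? M v) * f v)                       ≡⟨ ∑-cong (vectors n) coordinates ⟩
    (∑[ v ∈ vectors n ] ∑[ x ∈ vectors s ] 𝟙 (eq? v (lincomb x B)) * f v) ≡⟨ ∑-swap (vectors n) (vectors s) _ ⟩
    (∑[ x ∈ vectors s ] ∑[ v ∈ vectors n ] 𝟙 (eq? v (lincomb x B)) * f v) ≡⟨ ∑-cong (vectors s) value ⟩
    (∑[ x ∈ vectors s ] f (lincomb x B))                                 ∎
    where
    eq? : ∀ (v w : Vector Carrier n) → Dec (v ≋ w)
    eq? v w = Fin.all? λ j → v j ≟ w j

    coordinates : ∀ v → 𝟙 (inRowSpace? M v) * f v ≡ (∑[ x ∈ vectors s ] 𝟙 (eq? v (lincomb x B)) * f v)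
    coordinates v = 𝟙*-cases (inRowSpace? M v) inside outside
      where
      outside : ¬ InRowSpace M v → 0 ≡ (∑[ x ∈ vectors s ] 𝟙 (eq? v (lincomb x B)) * f v)
      outside v∉M = sym (∑-zero (vectors s) λ x →
        cong (_* f v) (𝟙-no (eq? v (lincomb x B)) λ eq → v∉M (InRowSpace-⊆ B⊆M (x , eq))))
      inside : InRowSpace M v → f v ≡ (∑[ x ∈ vectors s ] 𝟙 (eq? v (lincomb x B)) * f v)
      inside v∈M with InRowSpace-⊆ M⊆B v∈M
      ... | y , v≋yB = sym (begin
        (∑[ x ∈ vectors s ] 𝟙 (eq? v (lincomb x B)) * f v) ≡⟨ vectors-enumerate s y
            (λ {x} {x′} x≋x′ → cong (_* f v) (𝟙-cong (eq? v (lincomb x B)) (eq? v (lincomb x′ B))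
              (λ eq j → ≈-trans (eq j) (lincomb-cong {B = B} {C = B} x≋x′ (λ _ _ → ≈-refl) j))
              (λ eq j → ≈-trans (eq j) (≈-sym (lincomb-cong {B = B} {C = B} x≋x′ (λ _ _ → ≈-refl) j)))))
            (λ x x≉y → cong (_* f v) (𝟙-no (eq? v (lincomb x B)) λ eq →
              x≉y (independent-injective ind x y λ j → ≈-trans (≈-sym (eq j)) (v≋yB j)))) ⟩
        𝟙 (eq? v (lincomb y B)) * f v                      ≡⟨ cong (_* f v) (𝟙-yes (eq? v (lincomb y B)) v≋yB) ⟩
        1 * f v                                            ≡⟨ ℕ.*-identityˡ (f v) ⟩
        f v                                                ∎)

    value : ∀ x → (∑[ v ∈ vectors n ] 𝟙 (eq? v (lincomb x B)) * f v) ≡ f (lincomb x B)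
    value x = begin
      (∑[ v ∈ vectors n ] 𝟙 (eq? v (lincomb x B)) * f v) ≡⟨ vectors-enumerate n (lincomb x B)
          (λ {u} {v} u≋v → cong₂ _*_ (𝟙-cong (eq? u _) (eq? v _)
            (λ eq j → ≈-trans (≈-sym (u≋v j)) (eq j)) (λ eq j → ≈-trans (u≋v j) (eq j))) (f-cong u≋v))
          (λ v v≉ → cong (_* f v) (𝟙-no (eq? v _) v≉)) ⟩
      𝟙 (eq? (lincomb x B) (lincomb x B)) * f (lincomb x B) ≡⟨ cong (_* f (lincomb x B)) (𝟙-yes (eq? _ _) λ _ → ≈-refl) ⟩
      1 * f (lincomb x B)                                   ≡⟨ ℕ.*-identityˡ _ ⟩
      f (lincomb x B)                                       ∎

  rowSpace-size : ∀ {s k n} {M : Matrix k n} → HasRank s M → (∑[ v ∈ vectors n ] 𝟙 (inRowSpace? M v) * 1) ≡ q ^ s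
  rowSpace-size {s} (B , basis) =
    trans (∑-rowSpace basis (λ _ → refl)) (trans (∑-one (vectors s)) (length-vectors s))

  rank-unique : ∀ {s t k n} {M : Matrix k n} → HasRank s M → HasRank t M → s ≡ t
  rank-unique {s} {t} r r′ with ℕ.<-cmp s t | trans (sym (rowSpace-size r)) (rowSpace-size r′)
  ... | tri< s<t _ _ | eq = contradiction eq (ℕ.<⇒≢ (ℕ.^-monoʳ-< q 2≤q s<t))
  ... | tri≈ _ s≡t _ | _  = s≡t
  ... | tri> _ _ t<s | eq = contradiction (sym eq) (ℕ.<⇒≢ (ℕ.^-monoʳ-< q 2≤q t<s))

  -- M has some rank s′, `preserves` carries it to N, and uniqueness there gives t + s′ = t + s.
  -- Thus a one-way rank construction yields its converse: t = 0 serves a dependent row or a zero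
  -- column, t = 1 an independent row.
  rank-reflected : ∀ {h k m n s t} {M : Matrix h m} {N : Matrix k n} →
                   (∀ {s} → HasRank s M → HasRank (t + s) N) → HasRank (t + s) N → HasRank s M
  rank-reflected {s = s} {t} {M} preserves r with rank-exists M
  ... | s′ , r′ = subst (λ s → HasRank s M) (ℕ.+-cancelˡ-≡ t s′ s (rank-unique (preserves r′) r)) r′

  𝟙≉0 : Carrier → ℕ
  𝟙≉0 x = 𝟙 (¬? (x ≟ 0#))

  𝟙≉0-cong : Congruent _≈_ _≡_ 𝟙≉0
  𝟙≉0-cong {x} {y} x≈y = 𝟙-cong (¬? (x ≟ 0#)) (¬? (y ≟ 0#))
    (λ x≉0 y≈0 → x≉0 (≈-trans x≈y y≈0)) (λ y≉0 x≈0 → y≉0 (≈-trans (≈-sym x≈y) x≈0))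

  affine-nonzeros : ∀ {b} → ¬ b ≈ 0# → ∀ d → (∑[ x ∈ elements ] 𝟙≉0 (x ⊗ b ⊕ d)) ≡ q ∸ 1
  affine-nonzeros {b} b≉0 d with affine-root b≉0 d
  ... | w , root , unique = begin
    -- `1 + n ∸ 1` computes to `n`; the 1 is the single root of x b + d, which completes the count
    -- to all q elements.
    (∑[ x ∈ elements ] 𝟙≉0 (x ⊗ b ⊕ d))       ≡⟨⟩
    1 + (∑[ x ∈ elements ] 𝟙≉0 (x ⊗ b ⊕ d)) ∸ 1 ≡⟨ cong (_∸ 1) total ⟩
    q ∸ 1                                     ∎
    where
    f : Carrier → ℕ
    f x = 𝟙 (x ⊗ b ⊕ d ≟ 0#)

    f-cong : Congruent _≈_ _≡_ f
    f-cong {x} {y} x≈y = 𝟙-cong (x ⊗ b ⊕ d ≟ 0#) (y ⊗ b ⊕ d ≟ 0#)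
      (≈-trans (≈-sym eq)) (≈-trans eq)
      where
      eq : x ⊗ b ⊕ d ≈ y ⊗ b ⊕ d
      eq = ⊕-congʳ (*-congʳ x≈y)

    zeros : ∑ elements f ≡ 1
    zeros = trans (elements-enumerate w f-cong λ x x≉w → 𝟙-no (x ⊗ b ⊕ d ≟ 0#) (x≉w ∘ unique x))
                  (𝟙-yes (w ⊗ b ⊕ d ≟ 0#) root)

    total : 1 + (∑[ x ∈ elements ] 𝟙≉0 (x ⊗ b ⊕ d)) ≡ q
    total = begin
      1 + (∑[ x ∈ elements ] 𝟙≉0 (x ⊗ b ⊕ d))          ≡⟨ cong (_+ (∑[ x ∈ elements ] 𝟙≉0 (x ⊗ b ⊕ d))) zeros ⟨
      ∑ elements f + (∑[ x ∈ elements ] 𝟙≉0 (x ⊗ b ⊕ d)) ≡⟨ ∑-+ elements f _ ⟨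
      (∑[ x ∈ elements ] f x + 𝟙≉0 (x ⊗ b ⊕ d))        ≡⟨ ∑-cong elements (λ x → 𝟙-¬ (x ⊗ b ⊕ d ≟ 0#)) ⟩
      (∑[ x ∈ elements ] 1)                            ≡⟨ ∑-one elements ⟩
      List.length elements                             ≡⟨ length-elements ⟩
      q                                                ∎

  -- The factor q avoids the exponent s - 1.
  functional-nonzeros : ∀ {s} (b : Vector Carrier s) i → ¬ b i ≈ 0# → ∀ d →
    q * (∑[ x ∈ vectors s ] 𝟙≉0 (sumᶠ (λ i → x i ⊗ b i) ⊕ d)) ≡ (q ∸ 1) * q ^ s
  functional-nonzeros {suc s} b i bi≉0 d with b zero ≟ 0#
  -- With b₀ nonzero, any choice of the other coordinates leaves an affine condition on x₀ alone,
  -- met by q - 1 elements.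
  functional-nonzeros {suc s} b i bi≉0 d | no b₀≉0 = begin
    q * (∑[ x ∈ vectors (suc s) ] 𝟙≉0 (sumᶠ (λ i → x i ⊗ b i) ⊕ d))
      ≡⟨ cong (q *_) (∑-tuples elements s _) ⟩
    q * (∑[ x₀ ∈ elements ] ∑[ x ∈ vectors s ] 𝟙≉0 (x₀ ⊗ b zero ⊕ rest x ⊕ d))
      ≡⟨ cong (q *_) (∑-swap elements (vectors s) _) ⟩
    q * (∑[ x ∈ vectors s ] ∑[ x₀ ∈ elements ] 𝟙≉0 (x₀ ⊗ b zero ⊕ rest x ⊕ d))
      ≡⟨ cong (q *_) (∑-cong (vectors s) λ x → trans
           (∑-cong elements λ x₀ → 𝟙≉0-cong (⊕-assoc (x₀ ⊗ b zero) (rest x) d))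
           (affine-nonzeros b₀≉0 (rest x ⊕ d))) ⟩
    q * (∑[ x ∈ vectors s ] q ∸ 1)
      ≡⟨ cong (q *_) (trans (∑-const (vectors s) (q ∸ 1)) (cong (_* (q ∸ 1)) (length-vectors s))) ⟩
    q * (q ^ s * (q ∸ 1))
      ≡⟨ solve 3 (λ q a p → q :* (p :* a) := a :* (q :* p)) refl q (q ∸ 1) (q ^ s) ⟩
    (q ∸ 1) * (q * q ^ s) ∎
    where
    rest : Vector Carrier s → Carrier
    rest x = sumᶠ λ i → x i ⊗ b (suc i)
  functional-nonzeros {suc s} b zero    bi≉0 d | yes b₀≈0 = contradiction b₀≈0 bi≉0
  -- With b₀ = 0 the coordinate x₀ is free and contributes a factor q, and the nonzero coefficient
  -- lies in the tail.
  functional-nonzeros {suc s} b (suc i) bi≉0 d | yes b₀≈0 = begin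
    q * (∑[ x ∈ vectors (suc s) ] 𝟙≉0 (sumᶠ (λ i → x i ⊗ b i) ⊕ d))
      ≡⟨ cong (q *_) (∑-tuples elements s _) ⟩
    q * (∑[ x₀ ∈ elements ] ∑[ x ∈ vectors s ] 𝟙≉0 (x₀ ⊗ b zero ⊕ rest x ⊕ d))
      ≡⟨ cong (q *_) (∑-cong elements λ x₀ → ∑-cong (vectors s) λ x → 𝟙≉0-cong (⊕-congʳ (drop x₀ (rest x)))) ⟩
    q * (∑[ x₀ ∈ elements ] ∑[ x ∈ vectors s ] 𝟙≉0 (rest x ⊕ d))
      ≡⟨ cong (q *_) (trans (∑-const elements _) (cong (_* (∑[ x ∈ vectors s ] 𝟙≉0 (rest x ⊕ d))) length-elements)) ⟩
    q * (q * (∑[ x ∈ vectors s ] 𝟙≉0 (rest x ⊕ d)))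
      ≡⟨ cong (q *_) (functional-nonzeros (Vector.tail b) i bi≉0 d) ⟩
    q * ((q ∸ 1) * q ^ s)
      ≡⟨ solve 3 (λ q a p → q :* (a :* p) := a :* (q :* p)) refl q (q ∸ 1) (q ^ s) ⟩
    (q ∸ 1) * (q * q ^ s) ∎
    where
    rest : Vector Carrier s → Carrier
    rest x = sumᶠ λ i → x i ⊗ b (suc i)
    drop : ∀ x₀ y → x₀ ⊗ b zero ⊕ y ≈ y
    drop x₀ y = ≈-trans (⊕-congʳ (≈-trans (⊗-congˡ b₀≈0) (⊗-zeroʳ x₀))) (⊕-identityˡ y)

  hits : ∀ {k n} → Matrix k (suc n) → Carrier → ℕ
  hits {n = n} N d = ∑[ v ∈ vectors (suc n) ] 𝟙 (inRowSpace? N v) * 𝟙≉0 (v zero ⊕ d)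

  hits-basis : ∀ {s k n} {B : Matrix s (suc n)} {N : Matrix k (suc n)} → IsRowBasis B N → ∀ d →
               hits N d ≡ (∑[ x ∈ vectors s ] 𝟙≉0 (lincomb x B zero ⊕ d))
  hits-basis basis d = ∑-rowSpace basis λ u≋v → 𝟙≉0-cong (⊕-congʳ (u≋v zero))

  hits-zeroColumn : ∀ {s k n} {N : Matrix k (suc n)} → HasRank s N → ZeroColumn N → ∀ d → hits N d ≡ q ^ s * 𝟙≉0 d
  hits-zeroColumn {s} {N = N} (B , basis@(_ , B⊆N , _)) N0 d = begin
    hits N d                                        ≡⟨ hits-basis basis d ⟩
    (∑[ x ∈ vectors s ] 𝟙≉0 (lincomb x B zero ⊕ d)) ≡⟨ ∑-cong (vectors s) (λ x → 𝟙≉0-cong (≈-trans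
                                                         (⊕-congʳ (lincomb-zeroʳ x B zero (zeroColumn-⊆ B⊆N N0))) (⊕-identityˡ d))) ⟩
    (∑[ x ∈ vectors s ] 𝟙≉0 d)                      ≡⟨ ∑-const (vectors s) _ ⟩
    List.length (vectors s) * 𝟙≉0 d                 ≡⟨ cong (_* 𝟙≉0 d) (length-vectors s) ⟩
    q ^ s * 𝟙≉0 d                                   ∎

  hits-nonzeroColumn : ∀ {s k n} {N : Matrix k (suc n)} → HasRank s N → ¬ ZeroColumn N → ∀ d →
                       q * hits N d ≡ (q ∸ 1) * q ^ s
  hits-nonzeroColumn {s} (B , basis@(_ , _ , N⊆B)) N≉0 d
    -- The rows of N are combinations of those of B, so a zero first column of B would force one in
    -- N. Hence Σ xᵢ Bᵢ₁ is a nonzero linear form in x.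
    with Fin.¬∀⟶∃¬ s _ (λ i → B i zero ≟ 0#) (λ B0 → N≉0 (zeroColumn-⊆ N⊆B B0))
  ... | i , Bi≉0 = trans (cong (q *_) (hits-basis basis d)) (functional-nonzeros (λ i → B i zero) i Bi≉0 d)

  -- Each row is cut into its first entry and the rest. Since f vanishes when that entry is nonzero,
  -- the sum over it collapses to its value at 0; the other rows follow by induction.
  ∑-zeroColumn : ∀ a {b} {f : Matrix a (suc b) → ℕ} → (∀ {M N} → (∀ i → M i ≋ N i) → f M ≡ f N) →
                 (∀ N → ¬ ZeroColumn N → f N ≡ 0) →
                 ∑ (matrices a (suc b)) f ≡ (∑[ N ∈ matrices a b ] f (padZero N))
  ∑-zeroColumn zero    f-cong off = cong (_+ 0) (f-cong λ ())
  ∑-zeroColumn (suc a) {b} {f} f-cong off = begin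
    ∑ (matrices (suc a) (suc b)) f
      ≡⟨ ∑-tuples (vectors (suc b)) a f ⟩
    (∑[ v ∈ vectors (suc b) ] ∑[ N ∈ matrices a (suc b) ] f (v Vector.∷ N))
      ≡⟨ ∑-tuples elements b _ ⟩
    (∑[ x ∈ elements ] ∑[ v ∈ vectors b ] ∑[ N ∈ matrices a (suc b) ] f ((x Vector.∷ v) Vector.∷ N))
      ≡⟨ elements-enumerate 0#
          (λ x≈y → ∑-cong (vectors b) λ v → ∑-cong (matrices a (suc b)) λ N →
            f-cong (∷-cong (≋-setoid _) (∷-cong setoid x≈y λ _ → ≈-refl) λ _ _ → ≈-refl))
          (λ x x≉0 → ∑-zero (vectors b) λ v → ∑-zero (matrices a (suc b)) λ N → off _ λ N0 → x≉0 (N0 zero)) ⟩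
    (∑[ v ∈ vectors b ] ∑[ N ∈ matrices a (suc b) ] f ((0# Vector.∷ v) Vector.∷ N))
      ≡⟨ ∑-cong (vectors b) (λ v → ∑-zeroColumn a
          (λ M≋N → f-cong (∷-cong (≋-setoid _) (λ _ → ≈-refl) M≋N))
          (λ N N≉0 → off _ λ N0 → N≉0 (N0 ∘ suc))) ⟩
    (∑[ v ∈ vectors b ] ∑[ N ∈ matrices a b ] f ((0# Vector.∷ v) Vector.∷ padZero N))
      ≡⟨ ∑-cong (vectors b) (λ v → ∑-cong (matrices a b) λ N →
          f-cong λ { zero _ → ≈-refl ; (suc i) _ → ≈-refl }) ⟩
    (∑[ v ∈ vectors b ] ∑[ N ∈ matrices a b ] f (padZero (v Vector.∷ N)))
      ≡⟨ ∑-tuples (vectors b) a _ ⟨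
    (∑[ N ∈ matrices (suc a) b ] f (padZero N)) ∎

  -- With brackets for indicators, the two cases say [rank (v∷N) = t+1] = [v in N] [rank N = t+1] +
  -- (1 - [v in N]) [rank N = t]; the negative term is moved to the left to stay in ℕ.
  rank-∷ : ∀ {k n t} (v : Vector Carrier n) (N : Matrix k n) →
    𝟙 (hasRank? (suc t) (v Vector.∷ N)) + 𝟙 (inRowSpace? N v) * 𝟙 (hasRank? t N)
      ≡ 𝟙 (inRowSpace? N v) * 𝟙 (hasRank? (suc t) N) + 𝟙 (hasRank? t N)
  rank-∷ {t = t} v N = by-cases (inRowSpace? N v)
    where
    R₁ = hasRank? (suc t) (v Vector.∷ N)
    by-cases : ∀ (d : Dec (InRowSpace N v)) →
               𝟙 R₁ + 𝟙 d * 𝟙 (hasRank? t N) ≡ 𝟙 d * 𝟙 (hasRank? (suc t) N) + 𝟙 (hasRank? t N)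
    by-cases (yes v∈N) = cong₂ _+_
      (trans (𝟙-cong R₁ (hasRank? (suc t) N) (rank-reflected {t = 0} (rank-∷-dependent v∈N)) (rank-∷-dependent v∈N))
             (sym (ℕ.*-identityˡ _)))
      (ℕ.*-identityˡ _)
    by-cases (no v∉N) = trans (ℕ.+-identityʳ _)
      (𝟙-cong R₁ (hasRank? t N) (rank-reflected {t = 1} (rank-∷-independent v∉N)) (rank-∷-independent v∉N))

  -- All coordinates but the first are free, and the first obeys an affine condition of slope 1.
  -- This count over unrestricted v is the source of q^(m-1) in the last term of the theorem.
  shifted-nonzeros : ∀ n d → (∑[ v ∈ vectors (suc n) ] 𝟙≉0 (v zero ⊕ d)) ≡ (q ∸ 1) * q ^ n
  shifted-nonzeros n d = begin
    (∑[ v ∈ vectors (suc n) ] 𝟙≉0 (v zero ⊕ d))              ≡⟨ ∑-tuples elements n _ ⟩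
    (∑[ x ∈ elements ] ∑[ v ∈ vectors n ] 𝟙≉0 (x ⊕ d))       ≡⟨ ∑-cong elements (λ x → trans (∑-const (vectors n) _)
        (trans (cong (_* 𝟙≉0 (x ⊕ d)) (length-vectors n)) (ℕ.*-comm (q ^ n) _))) ⟩
    (∑[ x ∈ elements ] 𝟙≉0 (x ⊕ d) * q ^ n)                  ≡⟨ ∑-*ʳ elements _ (q ^ n) ⟩
    (∑[ x ∈ elements ] 𝟙≉0 (x ⊕ d)) * q ^ n                  ≡⟨ cong (_* q ^ n) (∑-cong elements λ x →
        𝟙≉0-cong (⊕-congʳ (≈-sym (*-identityʳ x)))) ⟩
    (∑[ x ∈ elements ] 𝟙≉0 (x ⊗ 1# ⊕ d)) * q ^ n             ≡⟨ cong (_* q ^ n) (affine-nonzeros 1≉0 d) ⟩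
    (q ∸ 1) * q ^ n                                          ∎

  -- Removing the first row and column; `r`, `l`, `m` are one less than in the theorem.

  module Recursion (r l m : ℕ) .(r≤l : r ≤ l) .(r≤m : r ≤ m) where

    -- In this form `τ (suc r)` of `v ∷ N` unfolds by computation to `v zero ⊕ τ′ N`.
    τ′ : Matrix l (suc m) → Carrier
    τ′ N = τ r r≤l r≤m (λ i → Vector.tail (N i))

    τ′-cong : ∀ {M N} → (∀ i → M i ≋ N i) → τ′ M ≈ τ′ N
    τ′-cong M≋N = sumᶠ-cong λ i → M≋N (inject≤ i r≤l) (suc (inject≤ i r≤m))

    W : ℕ → ℕ
    W s = ∑[ N ∈ matrices l (suc m) ] 𝟙 (hasRank? s N) * hits N (τ′ N)

    -- This is `rank-∷` weighted by the indicator of v₁ + τ′(N) ≠ 0 and summed over v.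
    row-extensions : ∀ t N →
      (∑[ v ∈ vectors (suc m) ] 𝟙 (hasRank? (suc t) (v Vector.∷ N)) * 𝟙≉0 (v zero ⊕ τ′ N))
        + 𝟙 (hasRank? t N) * hits N (τ′ N)
      ≡ 𝟙 (hasRank? (suc t) N) * hits N (τ′ N) + 𝟙 (hasRank? t N) * ((q ∸ 1) * q ^ m)
    row-extensions t N = begin
      ∑ vs (λ v → R₁ v * z v) + R * hits N (τ′ N)
        ≡⟨ cong (∑ vs (λ v → R₁ v * z v) +_) (∑-*ˡ vs R _) ⟨
      ∑ vs (λ v → R₁ v * z v) + ∑ vs (λ v → R * (I v * z v))
        ≡⟨ ∑-+ vs _ _ ⟨
      ∑ vs (λ v → R₁ v * z v + R * (I v * z v))
        ≡⟨ ∑-cong vs (λ v → begin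
             R₁ v * z v + R * (I v * z v)
               ≡⟨ solve 4 (λ r₁ r i z → r₁ :* z :+ r :* (i :* z) := (r₁ :+ i :* r) :* z) refl (R₁ v) R (I v) (z v) ⟩
             (R₁ v + I v * R) * z v
               ≡⟨ cong (_* z v) (rank-∷ v N) ⟩
             (I v * R′ + R) * z v
               ≡⟨ solve 4 (λ r′ r i z → (i :* r′ :+ r) :* z := r′ :* (i :* z) :+ r :* z) refl R′ R (I v) (z v) ⟩
             R′ * (I v * z v) + R * z v ∎) ⟩
      ∑ vs (λ v → R′ * (I v * z v) + R * z v)
        ≡⟨ ∑-+ vs _ _ ⟩
      ∑ vs (λ v → R′ * (I v * z v)) + ∑ vs (λ v → R * z v)
        ≡⟨ cong₂ _+_ (∑-*ˡ vs R′ _) (∑-*ˡ vs R z) ⟩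
      R′ * hits N (τ′ N) + R * ∑ vs z
        ≡⟨ cong (λ k → R′ * hits N (τ′ N) + R * k) (shifted-nonzeros m (τ′ N)) ⟩
      R′ * hits N (τ′ N) + R * ((q ∸ 1) * q ^ m) ∎
      where
      vs = vectors (suc m)
      R  = 𝟙 (hasRank? t N)
      R′ = 𝟙 (hasRank? (suc t) N)
      R₁ I z : Vector Carrier (suc m) → ℕ
      R₁ v = 𝟙 (hasRank? (suc t) (v Vector.∷ N))
      I v  = 𝟙 (inRowSpace? N v)
      z v  = 𝟙≉0 (v zero ⊕ τ′ N)

    first-row : ∀ t → 𝔴 (suc r) (suc t) (suc l) (suc m) (s≤s r≤l) (s≤s r≤m) + W t
                      ≡ W (suc t) + μ t l (suc m) * ((q ∸ 1) * q ^ m)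
    first-row t = begin
      𝔴 (suc r) (suc t) (suc l) (suc m) (s≤s r≤l) (s≤s r≤m) + W t
        ≡⟨ cong (_+ W t) (begin
             𝔴 (suc r) (suc t) (suc l) (suc m) (s≤s r≤l) (s≤s r≤m)
               ≡⟨ count≡∑ _ (matrices (suc l) (suc m)) ⟩
             ∑ (matrices (suc l) (suc m)) _
               ≡⟨ ∑-tuples (vectors (suc m)) l _ ⟩
             ∑ (vectors (suc m)) _
               ≡⟨ ∑-swap (vectors (suc m)) Ns _ ⟩
             (∑[ N ∈ Ns ] ∑[ v ∈ vectors (suc m) ]
               𝟙 (hasRank? (suc t) (v Vector.∷ N) ×-dec ¬? (v zero ⊕ τ′ N ≟ 0#)))
               ≡⟨ ∑-cong Ns (λ N → ∑-cong (vectors (suc m)) λ v → 𝟙-× (hasRank? (suc t) (v Vector.∷ N)) (¬? (v zero ⊕ τ′ N ≟ 0#))) ⟩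
             ∑ Ns extensions ∎) ⟩
      ∑ Ns extensions + W t
        ≡⟨ ∑-+ Ns _ _ ⟨
      (∑[ N ∈ Ns ] extensions N + 𝟙 (hasRank? t N) * hits N (τ′ N))
        ≡⟨ ∑-cong Ns (row-extensions t) ⟩
      (∑[ N ∈ Ns ] 𝟙 (hasRank? (suc t) N) * hits N (τ′ N) + 𝟙 (hasRank? t N) * ((q ∸ 1) * q ^ m))
        ≡⟨ ∑-+ Ns _ _ ⟩
      W (suc t) + (∑[ N ∈ Ns ] 𝟙 (hasRank? t N) * ((q ∸ 1) * q ^ m))
        ≡⟨ cong (W (suc t) +_) (∑-*ʳ Ns _ _) ⟩
      W (suc t) + (∑[ N ∈ Ns ] 𝟙 (hasRank? t N)) * ((q ∸ 1) * q ^ m)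
        ≡⟨ cong (λ k → W (suc t) + k * ((q ∸ 1) * q ^ m)) (count≡∑ (hasRank? t) Ns) ⟨
      W (suc t) + μ t l (suc m) * ((q ∸ 1) * q ^ m) ∎
      where
      Ns = matrices l (suc m)
      extensions : Matrix l (suc m) → ℕ
      extensions N = ∑[ v ∈ vectors (suc m) ] 𝟙 (hasRank? (suc t) (v Vector.∷ N)) * 𝟙≉0 (v zero ⊕ τ′ N)

    Z : Matrix l (suc m) → ℕ
    Z N = 𝟙 (zeroColumn? N)

    Z-cong : ∀ {M N} → (∀ i → M i ≋ N i) → Z M ≡ Z N
    Z-cong {M} {N} M≋N = 𝟙-cong (zeroColumn? M) (zeroColumn? N)
      (λ M0 i → ≈-trans (≈-sym (M≋N i zero)) (M0 i)) (λ N0 i → ≈-trans (M≋N i zero) (N0 i))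

    rank-cong : ∀ s {M N : Matrix l (suc m)} → (∀ i → M i ≋ N i) → 𝟙 (hasRank? s M) ≡ 𝟙 (hasRank? s N)
    rank-cong s {M} {N} M≋N = 𝟙-cong (hasRank? s M) (hasRank? s N)
      (HasRank-cong M≋N) (HasRank-cong λ i j → ≈-sym (M≋N i j))

    -- Matrices with zero first column are the paddings of matrices with one column less, and
    -- `rank-reflected` makes padding preserve rank in both directions.
    ∑-delete-zeroColumn : ∀ s {g : Matrix l (suc m) → ℕ} → (∀ {M N} → (∀ i → M i ≋ N i) → g M ≡ g N) →
      (∑[ N ∈ matrices l (suc m) ] Z N * (𝟙 (hasRank? s N) * g N))
        ≡ (∑[ N ∈ matrices l m ] 𝟙 (hasRank? s N) * g (padZero N))
    ∑-delete-zeroColumn s {g} g-cong = trans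
      (∑-zeroColumn l
        (λ M≋N → cong₂ _*_ (Z-cong M≋N) (cong₂ _*_ (rank-cong s M≋N) (g-cong M≋N)))
        (λ N N≉0 → cong (_* (𝟙 (hasRank? s N) * g N)) (𝟙-no (zeroColumn? N) N≉0)))
      (∑-cong (matrices l m) λ N → trans
        (cong₂ _*_ (𝟙-yes (zeroColumn? (padZero N)) λ _ → ≈-refl)
          (cong (_* g (padZero N)) (𝟙-cong (hasRank? s (padZero N)) (hasRank? s N)
            (rank-reflected {t = 0} padZero-rank) padZero-rank)))
        (ℕ.*-identityˡ _))

    -- Both column cases at once: q hits = Z q^(s+1) [τ′(N) ≠ 0] + (1 - Z) (q-1) q^s, with the
    -- negative term moved to the left.
    rank-hits : ∀ s N → HasRank s N →
      q * hits N (τ′ N) + Z N * ((q ∸ 1) * q ^ s) ≡ Z N * (q * (q ^ s * 𝟙≉0 (τ′ N))) + (q ∸ 1) * q ^ s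
    rank-hits s N rank = by-cases (zeroColumn? N)
      where
      by-cases : (d : Dec (ZeroColumn N)) →
        q * hits N (τ′ N) + 𝟙 d * ((q ∸ 1) * q ^ s) ≡ 𝟙 d * (q * (q ^ s * 𝟙≉0 (τ′ N))) + (q ∸ 1) * q ^ s
      by-cases (yes N0) = cong₂ _+_
        (trans (cong (q *_) (hits-zeroColumn rank N0 (τ′ N))) (sym (ℕ.*-identityˡ _))) (ℕ.*-identityˡ _)
      by-cases (no N≉0) = trans (ℕ.+-identityʳ _) (hits-nonzeroColumn rank N≉0 (τ′ N))

    -- Here `rank-hits` is summed over the N of rank s. The terms carrying `Z` become sums over
    -- matrices with one column less: weight 1 yields `μ s l m`, and weight [τ′(N) ≠ 0] yields
    -- `𝔴 r s l m`. The result is W(s) = (q-1) A(r,s) multiplied by q.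
    first-column : ∀ s →
      q * W s + ((q ∸ 1) * q ^ s) * μ s l m ≡ (q * q ^ s) * 𝔴 r s l m r≤l r≤m + ((q ∸ 1) * q ^ s) * μ s l (suc m)
    first-column s = begin
      q * W s + K * μ s l m
        ≡⟨ cong₂ (λ a b → a + K * b) (sym (∑-*ˡ Ns q _)) (begin
             μ s l m                                     ≡⟨ count≡∑ (hasRank? s) (matrices l m) ⟩
             (∑[ N ∈ matrices l m ] 𝟙 (hasRank? s N))    ≡⟨ ∑-cong (matrices l m) (λ N → ℕ.*-identityʳ _) ⟨
             (∑[ N ∈ matrices l m ] 𝟙 (hasRank? s N) * 1) ≡⟨ ∑-delete-zeroColumn s (λ _ → refl) ⟨
             (∑[ N ∈ Ns ] Z N * (R N * 1))               ∎) ⟩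
      (∑[ N ∈ Ns ] q * (R N * H N)) + K * (∑[ N ∈ Ns ] Z N * (R N * 1))
        ≡⟨ cong ((∑[ N ∈ Ns ] q * (R N * H N)) +_) (∑-*ˡ Ns K _) ⟨
      (∑[ N ∈ Ns ] q * (R N * H N)) + (∑[ N ∈ Ns ] K * (Z N * (R N * 1)))
        ≡⟨ ∑-+ Ns _ _ ⟨
      (∑[ N ∈ Ns ] q * (R N * H N) + K * (Z N * (R N * 1)))
        ≡⟨ ∑-cong Ns (λ N → begin
             q * (R N * H N) + K * (Z N * (R N * 1))
               ≡⟨ cong (λ x → q * (R N * H N) + K * (Z N * x)) (ℕ.*-identityʳ (R N)) ⟩
             q * (R N * H N) + K * (Z N * R N)
               ≡⟨ solve 5 (λ q r h k z → q :* (r :* h) :+ k :* (z :* r) := r :* (q :* h :+ z :* k)) refl q (R N) (H N) K (Z N) ⟩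
             R N * (q * H N + Z N * K)
               ≡⟨ 𝟙*-congˡ (hasRank? s N) (rank-hits s N) ⟩
             R N * (Z N * (q * (q ^ s * 𝟙≉0 (τ′ N))) + K)
               ≡⟨ solve 6 (λ q r p t k z → r :* (z :* (q :* (p :* t)) :+ k) := q :* p :* (z :* (r :* t)) :+ k :* r)
                    refl q (R N) (q ^ s) (𝟙≉0 (τ′ N)) K (Z N) ⟩
             (q * q ^ s) * (Z N * (R N * 𝟙≉0 (τ′ N))) + K * R N ∎) ⟩
      (∑[ N ∈ Ns ] (q * q ^ s) * (Z N * (R N * 𝟙≉0 (τ′ N))) + K * R N)
        ≡⟨ ∑-+ Ns _ _ ⟩
      (∑[ N ∈ Ns ] (q * q ^ s) * (Z N * (R N * 𝟙≉0 (τ′ N)))) + (∑[ N ∈ Ns ] K * R N)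
        ≡⟨ cong₂ _+_ (∑-*ˡ Ns (q * q ^ s) _) (∑-*ˡ Ns K _) ⟩
      (q * q ^ s) * (∑[ N ∈ Ns ] Z N * (R N * 𝟙≉0 (τ′ N))) + K * ∑ Ns R
        ≡⟨ cong₂ (λ a b → (q * q ^ s) * a + K * b)
             (begin
               (∑[ N ∈ Ns ] Z N * (R N * 𝟙≉0 (τ′ N)))
                 -- `τ′` of a padded matrix computes to `τ` of the original, since the added column
                 -- is the one that `τ′` drops.
                 ≡⟨ ∑-delete-zeroColumn s (λ M≋N → 𝟙≉0-cong (τ′-cong M≋N)) ⟩
               (∑[ N ∈ matrices l m ] 𝟙 (hasRank? s N) * 𝟙≉0 (τ r r≤l r≤m N))
                 ≡⟨ ∑-cong (matrices l m) (λ N → 𝟙-× (hasRank? s N) (¬? (τ r r≤l r≤m N ≟ 0#))) ⟨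
               (∑[ N ∈ matrices l m ] 𝟙 (hasRank? s N ×-dec ¬? (τ r r≤l r≤m N ≟ 0#)))
                 ≡⟨ count≡∑ _ (matrices l m) ⟨
               𝔴 r s l m r≤l r≤m ∎)
             (sym (count≡∑ (hasRank? s) Ns)) ⟩
      (q * q ^ s) * 𝔴 r s l m r≤l r≤m + K * μ s l (suc m) ∎
      where
      Ns = matrices l (suc m)
      K = (q ∸ 1) * q ^ s
      R H : Matrix l (suc m) → ℕ
      R N = 𝟙 (hasRank? s N)
      H N = hits N (τ′ N)

-- From identities in ℕ to the rational formula.

open import Data.Integer.Base as ℤ using (+_)
open import Data.Nat.Properties using (≤-trans)
open import Data.Rational.Base using (_+_; _-_; _*_)

module RationalArithmetic where
  open ≡ using (refl; sym; trans; cong; cong₂)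
  open ≡.≡-Reasoning

  toℚᵘ-/ : ∀ n d .{{_ : NonZero d}} → ℚ.toℚᵘ (+ n ℚ./ d) ℚᵘ.≃ (+ n ℚᵘ./ d)
  toℚᵘ-/ n (suc d) = ℚ.toℚᵘ-fromℚᵘ (ℚᵘ.mkℚᵘ (+ n) d)

  -- Division in ℚ reduces by a gcd, so the equation is checked in ℚᵘ, where it is a
  -- cross-multiplication. The laws for sums and products below go the same way.
  /-*-cancel : ∀ n d .{{_ : NonZero d}} → (+ n ℚ./ d) * ℕ→ℚ d ≡ ℕ→ℚ n
  /-*-cancel n d@(suc d-1) = ℚ.toℚᵘ-injective (begin′
    ℚ.toℚᵘ ((+ n ℚ./ d) * ℕ→ℚ d)                ≈⟨ ℚ.toℚᵘ-homo-* (+ n ℚ./ d) (ℕ→ℚ d) ⟩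
    ℚ.toℚᵘ (+ n ℚ./ d) ℚᵘ.* ℚ.toℚᵘ (ℕ→ℚ d)      ≈⟨ ℚᵘ.*-cong (toℚᵘ-/ n d) (toℚᵘ-/ d 1) ⟩
    (+ n ℚᵘ./ d) ℚᵘ.* (+ d ℚᵘ./ 1)              ≈⟨ ℚᵘ.*≡* (trans (ℤ.*-identityʳ _) (cong (λ k → + n ℤ.* + k) (sym (ℕ.*-identityʳ d)))) ⟩
    (+ n ℚᵘ./ 1)                                ≈⟨ toℚᵘ-/ n 1 ⟨
    ℚ.toℚᵘ (ℕ→ℚ n)                              ∎′)
    where open SetoidReasoning ℚᵘ.≃-setoid renaming (begin_ to begin′_; _∎ to _∎′)

  ℕ→ℚ-+ : ∀ m n → ℕ→ℚ (m ℕ.+ n) ≡ ℕ→ℚ m + ℕ→ℚ n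
  ℕ→ℚ-+ m n = ℚ.toℚᵘ-injective (begin′
    ℚ.toℚᵘ (ℕ→ℚ (m ℕ.+ n))                    ≈⟨ toℚᵘ-/ (m ℕ.+ n) 1 ⟩
    (+ (m ℕ.+ n) ℚᵘ./ 1)                      ≈⟨ ℚᵘ.*≡* (cong (ℤ._* + 1) (sym (cong₂ ℤ._+_ (ℤ.*-identityʳ (+ m)) (ℤ.*-identityʳ (+ n))))) ⟩
    (+ m ℚᵘ./ 1) ℚᵘ.+ (+ n ℚᵘ./ 1)            ≈⟨ ℚᵘ.+-cong (toℚᵘ-/ m 1) (toℚᵘ-/ n 1) ⟨
    ℚ.toℚᵘ (ℕ→ℚ m) ℚᵘ.+ ℚ.toℚᵘ (ℕ→ℚ n)        ≈⟨ ℚ.toℚᵘ-homo-+ (ℕ→ℚ m) (ℕ→ℚ n) ⟨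
    ℚ.toℚᵘ (ℕ→ℚ m + ℕ→ℚ n)                    ∎′)
    where open SetoidReasoning ℚᵘ.≃-setoid renaming (begin_ to begin′_; _∎ to _∎′)

  ℕ→ℚ-* : ∀ m n → ℕ→ℚ (m ℕ.* n) ≡ ℕ→ℚ m * ℕ→ℚ n
  ℕ→ℚ-* m n = ℚ.toℚᵘ-injective (begin′
    ℚ.toℚᵘ (ℕ→ℚ (m ℕ.* n))                    ≈⟨ toℚᵘ-/ (m ℕ.* n) 1 ⟩
    (+ (m ℕ.* n) ℚᵘ./ 1)                      ≈⟨ ℚᵘ.*≡* (cong (ℤ._* + 1) (ℤ.pos-* m n)) ⟩
    (+ m ℚᵘ./ 1) ℚᵘ.* (+ n ℚᵘ./ 1)            ≈⟨ ℚᵘ.*-cong (toℚᵘ-/ m 1) (toℚᵘ-/ n 1) ⟨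
    ℚ.toℚᵘ (ℕ→ℚ m) ℚᵘ.* ℚ.toℚᵘ (ℕ→ℚ n)        ≈⟨ ℚ.toℚᵘ-homo-* (ℕ→ℚ m) (ℕ→ℚ n) ⟨
    ℚ.toℚᵘ (ℕ→ℚ m * ℕ→ℚ n)                    ∎′)
    where open SetoidReasoning ℚᵘ.≃-setoid renaming (begin_ to begin′_; _∎ to _∎′)

  *-ℕ→ℚ-cancelʳ : ∀ d .{{_ : NonZero d}} {x y} → x * ℕ→ℚ d ≡ y * ℕ→ℚ d → x ≡ y
  *-ℕ→ℚ-cancelʳ d {x} {y} eq = begin
    x              ≡⟨ divide x ⟨
    x * ℕ→ℚ d * d⁻¹ ≡⟨ cong (_* d⁻¹) eq ⟩
    y * ℕ→ℚ d * d⁻¹ ≡⟨ divide y ⟩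
    y              ∎
    where
    d⁻¹ = + 1 ℚ./ d
    divide : ∀ z → z * ℕ→ℚ d * d⁻¹ ≡ z
    divide z = begin
      z * ℕ→ℚ d * d⁻¹   ≡⟨ ℚ.*-assoc z (ℕ→ℚ d) d⁻¹ ⟩
      z * (ℕ→ℚ d * d⁻¹) ≡⟨ cong (z *_) (trans (ℚ.*-comm (ℕ→ℚ d) d⁻¹) (/-*-cancel 1 d)) ⟩
      z * ℚ.1ℚ          ≡⟨ ℚ.*-identityʳ z ⟩
      z                 ∎

  ^ᶻ-pred : ∀ b .{{_ : NonZero b}} s → b ^ᶻ (+ s ℤ.- + 1) * ℕ→ℚ b ≡ ℕ→ℚ (b ℕ.^ s)
  -- At s = 0 the exponent is -1 and the power is 1 / b ^ 1, so the factor b is first rewritten as b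
  -- * 1, to which b ^ 1 computes.
  ^ᶻ-pred b zero    = trans (cong (λ k → b ^ᶻ (+ 0 ℤ.- + 1) * ℕ→ℚ k) (sym (ℕ.*-identityʳ b)))
                            (/-*-cancel 1 (b ℕ.^ 1) {{ℕ.m^n≢0 b 1}})
  ^ᶻ-pred b (suc s) = trans (sym (ℕ→ℚ-* (b ℕ.^ s) b)) (cong ℕ→ℚ (ℕ.*-comm (b ℕ.^ s) b))

  open ℚ-Solver.+-*-Solver using (solve; _:+_; _:*_; _:-_; _:=_)

  ℕ→ℚ-** : ∀ a b c → ℕ→ℚ ((a ℕ.* b) ℕ.* c) ≡ ℕ→ℚ a * ℕ→ℚ b * ℕ→ℚ c
  ℕ→ℚ-** a b c = trans (ℕ→ℚ-* (a ℕ.* b) c) (cong (_* ℕ→ℚ c) (ℕ→ℚ-* a b))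

  -- Turns `first-column` into (q-1) A(r,s) = W(s), for a = q - 1 and b = q. Multiplying both sides
  -- by b replaces b^(s-1) by b^s, including at s = 0.
  divide-column-count : ∀ b a .{{_ : NonZero b}} .{{_ : NonZero a}} s W w n n′ →
    b ℕ.* W ℕ.+ (a ℕ.* b ℕ.^ s) ℕ.* n′ ≡ (b ℕ.* b ℕ.^ s) ℕ.* w ℕ.+ (a ℕ.* b ℕ.^ s) ℕ.* n →
    (b ^ᶻ (+ s) * (+ w ℚ./ a) + b ^ᶻ (+ s ℤ.- + 1) * (ℕ→ℚ n - ℕ→ℚ n′)) * ℕ→ℚ a ≡ ℕ→ℚ W
  divide-column-count b a s W w n n′ eq = *-ℕ→ℚ-cancelʳ b (begin
    (p * ŵ + p⁻ * (ν - ν′)) * α * β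
      ≡⟨ solve 7 (λ p ŵ p⁻ ν ν′ α β → (p :* ŵ :+ p⁻ :* (ν :- ν′)) :* α :* β
                   := β :* p :* (ŵ :* α) :+ α :* (p⁻ :* β) :* ν :- α :* (p⁻ :* β) :* ν′) refl p ŵ p⁻ ν ν′ α β ⟩
    β * p * (ŵ * α) + α * (p⁻ * β) * ν - α * (p⁻ * β) * ν′
      ≡⟨ cong₂ (λ x y → β * p * x + α * y * ν - α * y * ν′) (/-*-cancel w a) (^ᶻ-pred b s) ⟩
    β * p * ℕ→ℚ w + α * p * ν - α * p * ν′
      ≡⟨ cong (_- α * p * ν′) counts ⟨
    β * ℕ→ℚ W + α * p * ν′ - α * p * ν′
      ≡⟨ solve 3 (λ x β w → β :* w :+ x :- x := w :* β) refl (α * p * ν′) β (ℕ→ℚ W) ⟩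
    ℕ→ℚ W * β ∎)
    where
    p  = ℕ→ℚ (b ℕ.^ s)
    p⁻ = b ^ᶻ (+ s ℤ.- + 1)
    α  = ℕ→ℚ a
    β  = ℕ→ℚ b
    ŵ  = + w ℚ./ a
    ν  = ℕ→ℚ n
    ν′ = ℕ→ℚ n′
    counts : β * ℕ→ℚ W + α * p * ν′ ≡ β * p * ℕ→ℚ w + α * p * ν
    counts = begin
      β * ℕ→ℚ W + α * p * ν′
        ≡⟨ cong₂ _+_ (ℕ→ℚ-* b W) (ℕ→ℚ-** a (b ℕ.^ s) n′) ⟨
      ℕ→ℚ (b ℕ.* W) + ℕ→ℚ ((a ℕ.* b ℕ.^ s) ℕ.* n′)
        ≡⟨ ℕ→ℚ-+ (b ℕ.* W) _ ⟨
      ℕ→ℚ (b ℕ.* W ℕ.+ (a ℕ.* b ℕ.^ s) ℕ.* n′)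
        ≡⟨ cong ℕ→ℚ eq ⟩
      ℕ→ℚ ((b ℕ.* b ℕ.^ s) ℕ.* w ℕ.+ (a ℕ.* b ℕ.^ s) ℕ.* n)
        ≡⟨ ℕ→ℚ-+ ((b ℕ.* b ℕ.^ s) ℕ.* w) _ ⟩
      ℕ→ℚ ((b ℕ.* b ℕ.^ s) ℕ.* w) + ℕ→ℚ ((a ℕ.* b ℕ.^ s) ℕ.* n)
        ≡⟨ cong₂ _+_ (ℕ→ℚ-** b (b ℕ.^ s) w) (ℕ→ℚ-** a (b ℕ.^ s) n) ⟩
      β * p * ℕ→ℚ w + α * p * ν ∎

  -- Turns `first-row` into the theorem: a = q - 1, p = q^(m-1), while A₀, A₁ stand for A(r,t-1),
  -- A(r,t) and W₀, W₁ for W(t-1), W(t).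
  divide-row-count : ∀ a .{{_ : NonZero a}} p w W₀ W₁ n A₀ A₁ →
    A₀ * ℕ→ℚ a ≡ ℕ→ℚ W₀ → A₁ * ℕ→ℚ a ≡ ℕ→ℚ W₁ →
    w ℕ.+ W₀ ≡ W₁ ℕ.+ n ℕ.* (a ℕ.* p) →
    + w ℚ./ a ≡ A₁ - A₀ + ℕ→ℚ p * ℕ→ℚ n
  divide-row-count a p w W₀ W₁ n A₀ A₁ eq₀ eq₁ eq = *-ℕ→ℚ-cancelʳ a (begin
    (+ w ℚ./ a) * α
      ≡⟨ /-*-cancel w a ⟩
    ℕ→ℚ w
      ≡⟨ solve 2 (λ x y → x := x :+ y :- y) refl (ℕ→ℚ w) (ℕ→ℚ W₀) ⟩
    ℕ→ℚ w + ℕ→ℚ W₀ - ℕ→ℚ W₀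
      ≡⟨ cong (_- ℕ→ℚ W₀) counts ⟩
    ℕ→ℚ W₁ + ν * (α * π) - ℕ→ℚ W₀
      ≡⟨ cong₂ (λ x y → x + ν * (α * π) - y) eq₁ eq₀ ⟨
    A₁ * α + ν * (α * π) - A₀ * α
      ≡⟨ solve 5 (λ a₁ a₀ α π ν → a₁ :* α :+ ν :* (α :* π) :- a₀ :* α := (a₁ :- a₀ :+ π :* ν) :* α) refl A₁ A₀ α π ν ⟩
    (A₁ - A₀ + π * ν) * α ∎)
    where
    α = ℕ→ℚ a
    π = ℕ→ℚ p
    ν = ℕ→ℚ n
    counts : ℕ→ℚ w + ℕ→ℚ W₀ ≡ ℕ→ℚ W₁ + ν * (α * π)
    counts = begin
      ℕ→ℚ w + ℕ→ℚ W₀                   ≡⟨ ℕ→ℚ-+ w W₀ ⟨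
      ℕ→ℚ (w ℕ.+ W₀)                   ≡⟨ cong ℕ→ℚ eq ⟩
      ℕ→ℚ (W₁ ℕ.+ n ℕ.* (a ℕ.* p))     ≡⟨ ℕ→ℚ-+ W₁ _ ⟩
      ℕ→ℚ W₁ + ℕ→ℚ (n ℕ.* (a ℕ.* p))   ≡⟨ cong (_+_ (ℕ→ℚ W₁)) (trans (ℕ→ℚ-* n (a ℕ.* p)) (cong (ν *_) (ℕ→ℚ-* a p))) ⟩
      ℕ→ℚ W₁ + ν * (α * π)             ∎

mainTheorem3 : ∀ {c e : Level} (q : ℕ) → IsPrimePower q → (F : FiniteField c e q) →
    let open Counting F in
    ∀ (r t l m : ℕ) → 1 ≤ r → (r≤l : r ≤ l) (l≤m : l ≤ m) → 1 ≤ t → t < l →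
    let r≤m = ≤-trans r≤l l≤m in
    𝔴̂ r t l m r≤l r≤m
    ≡ A l m r t r≤l r≤m - A l m r (t ∸ 1) r≤l r≤m
    + q ^ᶻ (+ m ℤ.- + 1) * ℕ→ℚ (μ (t ∸ 1) (l ∸ 1) m)
mainTheorem3 q _ F (suc r) (suc t) (suc l) (suc m) (s≤s _) (s≤s r≤l) (s≤s l≤m) (s≤s _) _ =
  -- Here `r`, `t`, `l`, `m` are one less than in the statement, so each `∸ 1` on them computes away
  -- and the exponent `+ suc m ℤ.- + 1` computes to `+ m`.
  RationalArithmetic.divide-row-count (q ∸ 1) (q ℕ.^ m) (𝔴 (suc r) (suc t) (suc l) (suc m) (s≤s r≤l) (s≤s r≤m)) (W t) (W (suc t)) (μ t l (suc m))
    (A′ t) (A′ (suc t)) (A-W t) (A-W (suc t)) (first-row t)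
  where
  open Counting F
  r≤m = ≤-trans r≤l l≤m
  open RankCounts.Recursion F r l m r≤l r≤m using (W; first-row; first-column)
  A′ : ℕ → ℚ
  A′ s = A (suc l) (suc m) (suc r) s (s≤s r≤l) (s≤s r≤m)
  A-W : ∀ s → A′ s * ℕ→ℚ (q ∸ 1) ≡ ℕ→ℚ (W s)
  A-W s = RationalArithmetic.divide-column-count q (q ∸ 1) s (W s) (𝔴 r s l m r≤l r≤m) (μ s l (suc m)) (μ s l m) (first-column s)
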